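{- Let $n\ge 2$ and $0\leq k\leq n-1$ be integers. The number of prime parking functions of length $n$ with exactly $k$ fixed points is $$\binom{n-1}{k}(n-2)^{n-k-1},$$ with the convention $0^0=1$.
   Context: A parking function of length $n$ is a sequence $\pi=(\pi_1,\dots,\pi_n)$ of positive integers such that, if $\lambda_1\le\cdots\le\lambda_n$ is the weakly increasing rearrangement of $\pi_1,\dots,\pi_n$, then $\lambda_i\le i$ for all $1\le i\le n$. A parking function $\pi$ of length $n$ is prime if for all $1\le j\le n-1$ one has $\#\{i: \pi_i\le j\}\ge j+1$. An index $i\in\{1,\dots,n\}$ is a fixed point of $\pi$ if $\pi_i=i$. -}

module Defs where

open import Data.Fin.Base using (Fin; toℕ)
open import Data.List.Base using (List; length)
open import Data.List.Membership.Propositional using (_∈_)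
open import Data.List.Relation.Binary.Permutation.Propositional using (_↭_)
open import Data.List.Relation.Unary.Unique.Propositional using (Unique)
open import Data.Nat.Base using (ℕ; suc; _∸_; _≤_)
open import Data.Nat.Properties using (_≟_; _≤?_; ≤-totalOrder)
open import Data.List.Relation.Unary.Sorted.TotalOrder ≤-totalOrder using (Sorted)
open import Data.Product.Base using (∃-syntax; _×_)
open import Data.Vec.Base using (Vec; allFin; count; lookup; toList)
open import Function.Bundles using (_⇔_)
open import Relation.Binary.PropositionalEquality.Core using (_≡_)

-- The set { x | P x } is listed without repetition, so the count does not
-- depend on how many proofs of P x there are.
HasCardinality : {A : Set} → (A → Set) → ℕ → Set
HasCardinality {A} P c =
  ∃[ xs ] Unique xs × (∀ (x : A) → x ∈ xs ⇔ P x) × length xs ≡ c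

-- Positions and values are numbered from 1, while Fin n starts at 0.
position : ∀ {n} → Fin n → ℕ
position i = suc (toℕ i)

-- A weakly increasing rearrangement exists and is unique, so it is
-- immaterial that `rearrangement` is a field rather than computed from π.
record IsParkingFunction {n} (π : Vec ℕ n) : Set where
  field
    positive      : ∀ i → 1 ≤ lookup π i
    rearrangement : Vec ℕ n
    permuted      : toList rearrangement ↭ toList π
    increasing    : Sorted (toList rearrangement)
    bounded       : ∀ i → lookup rearrangement i ≤ position i

#entries≤ : ∀ {n} → Vec ℕ n → ℕ → ℕ
#entries≤ {n} π j = count (λ i → lookup π i ≤? j) (allFin n)

record IsPrimeParkingFunction {n} (π : Vec ℕ n) : Set where
  field
    isParkingFunction : IsParkingFunction π
    prime             : ∀ j → 1 ≤ j → j ≤ n ∸ 1 → suc j ≤ #entries≤ π j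

#fixedPoints : ∀ {n} → Vec ℕ n → ℕ
#fixedPoints {n} π = count (λ i → lookup π i ≟ position i) (allFin n)

{-# OPTIONS --safe #-}
-- Let m = n − 1. The entries of a prime parking function lie in {1, …, m}, so
-- let ℤ/m act on {1, …, m}ⁿ by adding 1 to every entry and rotating the first
-- m positions. Primality depends only on the multiset of entries, which the
-- action shifts cyclically, so by the cycle lemma each orbit contains exactly
-- one prime parking function. The action preserves the number of fixed points
-- (position n is never one). Each orbit also contains exactly one word with
-- last entry 1; subtracting from each of its other m entries its position
-- turns fixed points into zeros, and there are C(m,k) (m−1)ᵐ⁻ᵏ words of length
-- m over ℤ/m with k zeros.
module Submission where

open import Defs
open import Algebra.Bundles using (AbelianGroup)
import Algebra.Properties.Group
open import Data.Bool.Base using (true; false; if_then_else_)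
open import Data.Fin.Base using (Fin; zero; suc; toℕ; inject₁; fromℕ; fromℕ<)
open import Data.Fin.Permutation using (Permutation′; permutation)
import Data.Fin.Properties as Fin
open import Data.List.Base as List using (List; []; _∷_; _++_; cartesianProductWith)
open import Data.List.Properties using (length-map; length-++; length-tabulate; filter-none)
open import Data.List.Membership.Propositional using (_∈_; _∉_)
open import Data.List.Relation.Binary.Disjoint.Propositional using (Disjoint)
open import Data.List.Membership.Propositional.Properties
  using (∈-map⁺; ∈-map⁻; ∈-++⁺ˡ; ∈-++⁺ʳ; ∈-++⁻; ∈-allFin; ∈-cartesianProductWith⁺; ∈-cartesianProductWith⁻)
open import Data.List.Relation.Binary.Permutation.Propositional using (_↭_)
open import Data.List.Relation.Binary.Permutation.Propositional.Properties using (↭-length; filter-↭)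
open import Data.List.Relation.Unary.All as All using ([])
open import Data.List.Relation.Unary.AllPairs using (AllPairs; []; _∷_)
open import Data.List.Relation.Unary.Any using (here)
open import Data.List.Relation.Unary.Sorted.TotalOrder.Properties using (Sorted⇒AllPairs)
open import Data.List.Relation.Unary.Unique.Propositional using (Unique)
import Data.List.Relation.Unary.Unique.Propositional.Properties as Unique
open import Data.Nat.Base
open import Data.Nat.Combinatorics using (_C_; nCn≡1; nCk≡nC[n∸k]; k>n⇒nCk≡0; nCk+nC[k+1]≡[n+1]C[k+1])
open import Data.Nat.DivMod using (_mod_; m%n<n; m<n⇒m%n≡m; n%n≡0; %-distribˡ-+; m≤n⇒[n∸m]%m≡n%m)
open import Data.Nat.Properties
open import Data.Nat.Tactic.RingSolver using (solve-∀)
open import Data.Product.Base using (∃-syntax; ∃₂; _×_; _,_; proj₁; proj₂)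
open import Data.Sum.Base using (_⊎_; inj₁; inj₂)
open import Data.Vec.Base as Vec
  using (Vec; []; _∷_; _∷ʳ_; allFin; count; fromList; initLast; lookup; map; tabulate; toList)
open import Data.Vec.Properties
  using (count≤n; length-toList; lookup-map; lookup∘tabulate; tabulate-cong; tabulate∘lookup;
         toList-cast; toList∘fromList; ∷-injectiveˡ; ∷-injectiveʳ; ∷ʳ-injective)
open import Function.Base using (_∘_)
open import Function.Bundles using (mk⇔; module Equivalence)
open import Level using (0ℓ)
open import Relation.Binary.Definitions using (tri<; tri≈; tri>)
open import Relation.Binary.PropositionalEquality hiding ([_])
open import Relation.Nullary
open import Relation.Unary using (Decidable)
open import Algebra.Properties.CommutativeMonoid.Sum +-0-commutativeMonoid
  using (sum; sum-cong-≗; ∑-distrib-+; sum-permute; sum-init-last)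
open import Algebra.Properties.CommutativeSemigroup *-commutativeSemigroup using (x∙yz≈y∙xz)
open import Data.List.Relation.Unary.Sorted.TotalOrder ≤-totalOrder using (Sorted)
open import Data.List.Sort ≤-decTotalOrder using (sort; sort-↭; sort-↗)

-- Indicators, counts and vectors

-- Turns counts into sums over `Fin n`, which can be added termwise and reindexed by a permutation.
⟦_⟧ : {P : Set} → Dec P → ℕ
⟦ P? ⟧ = if does P? then 1 else 0

⟦⟧-yes : {P : Set} (P? : Dec P) → P → ⟦ P? ⟧ ≡ 1
⟦⟧-yes (yes _) _ = refl
⟦⟧-yes (no ¬p) p = contradiction p ¬p

⟦⟧-no : {P : Set} (P? : Dec P) → ¬ P → ⟦ P? ⟧ ≡ 0
⟦⟧-no (yes p) ¬p = contradiction p ¬p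
⟦⟧-no (no _)  _  = refl

⟦⟧-cong : {P Q : Set} (P? : Dec P) (Q? : Dec Q) → (P → Q) → (Q → P) → ⟦ P? ⟧ ≡ ⟦ Q? ⟧
⟦⟧-cong (yes p) Q? P⇒Q _   = sym (⟦⟧-yes Q? (P⇒Q p))
⟦⟧-cong (no ¬p) Q? _   Q⇒P = sym (⟦⟧-no Q? (¬p ∘ Q⇒P))

sum-ones : ∀ n → sum {n} (λ _ → 1) ≡ n
sum-ones zero    = refl
sum-ones (suc n) = cong suc (sum-ones n)

sum-zeros : ∀ n → sum {n} (λ _ → 0) ≡ 0
sum-zeros zero    = refl
sum-zeros (suc n) = sum-zeros n

count≡sum : ∀ {A : Set} {P : A → Set} (P? : Decidable P) {n} (xs : Vec A n) →
  count P? xs ≡ sum (λ i → ⟦ P? (lookup xs i) ⟧)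
count≡sum P? []       = refl
count≡sum P? (x ∷ xs) with P? x
... | yes _ = cong suc (count≡sum P? xs)
... | no  _ = count≡sum P? xs

count-tabulate : ∀ {A : Set} {P : A → Set} (P? : Decidable P) {n} (f : Fin n → A) →
  count P? (tabulate f) ≡ sum (λ i → ⟦ P? (f i) ⟧)
count-tabulate P? {zero}  f = refl
count-tabulate P? {suc n} f with P? (f zero)
... | yes _ = cong suc (count-tabulate P? (f ∘ suc))
... | no  _ = count-tabulate P? (f ∘ suc)

-- A failing head would leave the whole count to the tail, which is one entry too short.
count-all : ∀ {A : Set} {P : A → Set} (P? : Decidable P) {n} (xs : Vec A n) →
  n ≤ count P? xs → ∀ i → P (lookup xs i)
count-all P? {suc n} (x ∷ xs) n<count i with P? x | i
... | yes px | zero  = px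
... | yes _  | suc i = count-all P? xs (s≤s⁻¹ n<count) i
... | no _   | _     = contradiction (≤-trans n<count (count≤n P? xs)) (n≮n n)

count-toList : ∀ {A : Set} {P : A → Set} (P? : Decidable P) {n} (xs : Vec A n) →
  count P? xs ≡ List.length (List.filter P? (toList xs))
count-toList P? []       = refl
count-toList P? (x ∷ xs) with P? x
... | yes _ = cong suc (count-toList P? xs)
... | no  _ = count-toList P? xs

count-↭ : ∀ {A : Set} {P : A → Set} (P? : Decidable P) {m n} (xs : Vec A m) (ys : Vec A n) →
  toList xs ↭ toList ys → count P? xs ≡ count P? ys
count-↭ P? xs ys xs↭ys = trans (count-toList P? xs)
  (trans (↭-length (filter-↭ P? xs↭ys)) (sym (count-toList P? ys)))

count-lookup : ∀ {A : Set} {P : A → Set} (P? : Decidable P) {n} (xs : Vec A n) →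
  count (λ i → P? (lookup xs i)) (allFin n) ≡ count P? xs
count-lookup P? xs = trans (count-tabulate (P? ∘ lookup xs) (λ i → i)) (sym (count≡sum P? xs))

module _ {A : Set} where
  count-∷ʳ : ∀ {P : A → Set} (P? : Decidable P) {n} (xs : Vec A n) x →
    count P? (xs ∷ʳ x) ≡ ⟦ P? x ⟧ + count P? xs
  count-∷ʳ P? [] x with P? x
  ... | yes _ = refl
  ... | no  _ = refl
  count-∷ʳ P? (y ∷ xs) x with P? y
  ... | yes _ = trans (cong suc (count-∷ʳ P? xs x)) (sym (+-suc ⟦ P? x ⟧ (count P? xs)))
  ... | no  _ = count-∷ʳ P? xs x

  count-map : ∀ {B : Set} {P : B → Set} (P? : Decidable P) (f : A → B) {n} (xs : Vec A n) →
    count P? (map f xs) ≡ count (P? ∘ f) xs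
  count-map P? f []       = refl
  count-map P? f (x ∷ xs) with P? (f x)
  ... | yes _ = cong suc (count-map P? f xs)
  ... | no  _ = count-map P? f xs

  lookup-∷ʳ-inject₁ : ∀ {n} (xs : Vec A n) x i → lookup (xs ∷ʳ x) (inject₁ i) ≡ lookup xs i
  lookup-∷ʳ-inject₁ (_ ∷ _)  x zero    = refl
  lookup-∷ʳ-inject₁ (_ ∷ xs) x (suc i) = lookup-∷ʳ-inject₁ xs x i

  lookup-∷ʳ-fromℕ : ∀ {n} (xs : Vec A n) x → lookup (xs ∷ʳ x) (fromℕ n) ≡ x
  lookup-∷ʳ-fromℕ []       x = refl
  lookup-∷ʳ-fromℕ (_ ∷ xs) x = lookup-∷ʳ-fromℕ xs x

  lookup-ext : ∀ {n} {xs ys : Vec A n} → (∀ i → lookup xs i ≡ lookup ys i) → xs ≡ ys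
  lookup-ext {xs = xs} {ys} eq =
    trans (sym (tabulate∘lookup xs)) (trans (tabulate-cong eq) (tabulate∘lookup ys))

  map-injective : ∀ {B : Set} {f : A → B} → (∀ {x y} → f x ≡ f y → x ≡ y) →
    ∀ {n} {xs ys : Vec A n} → map f xs ≡ map f ys → xs ≡ ys
  map-injective f-injective {xs = []}     {[]}     _  = refl
  map-injective f-injective {xs = x ∷ xs} {y ∷ ys} eq =
    cong₂ _∷_ (f-injective (∷-injectiveˡ eq)) (map-injective f-injective (∷-injectiveʳ eq))

position-injective : ∀ {n} {i j : Fin n} → position i ≡ position j → i ≡ j
position-injective = Fin.toℕ-injective ∘ suc-injective

-- Replaces entries in {1, ..., m} by elements of `Fin m`, on which arithmetic modulo m is
-- available.
toPositions : ∀ {m n} (π : Vec ℕ n) → (∀ i → 1 ≤ lookup π i) → (∀ i → lookup π i ≤ m) →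
  ∃[ ys ] map (position {m}) ys ≡ π
toPositions []          _        _       = [] , refl
toPositions (zero ∷ π)  positive _       = contradiction (positive zero) λ ()
toPositions (suc a ∷ π) positive bounded with toPositions π (positive ∘ suc) (bounded ∘ suc)
... | ys , eq = fromℕ< (bounded zero) ∷ ys , cong₂ _∷_ (cong suc (Fin.toℕ-fromℕ< (bounded zero))) eq

-- Words with a given number of zeros

HasCardinality-image : {A B : Set} {P : A → Set} {Q : B → Set} (f : A → B) →
  (∀ {x y} → f x ≡ f y → x ≡ y) → (∀ x → P x → Q (f x)) →
  (∀ y → Q y → ∃[ x ] P x × f x ≡ y) → ∀ {c} → HasCardinality P c → HasCardinality Q c
HasCardinality-image {P = P} {Q} f injective P⇒Q Q⇒P (xs , unique , members , refl) =
  List.map f xs , Unique.map⁺ injective unique , (λ y → mk⇔ (to y) (from y)) , length-map f xs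
  where
  to : ∀ y → y ∈ List.map f xs → Q y
  to y y∈ with ∈-map⁻ f y∈
  ... | x , x∈xs , refl = P⇒Q x (Equivalence.to (members x) x∈xs)
  from : ∀ y → Q y → y ∈ List.map f xs
  from y q with Q⇒P y q
  ... | x , px , refl = ∈-map⁺ f (Equivalence.from (members x) px)

length-cartesianProductWith : {A B C : Set} (f : A → B → C) (xs : List A) (ys : List B) →
  List.length (cartesianProductWith f xs ys) ≡ List.length xs * List.length ys
length-cartesianProductWith f []       ys = refl
length-cartesianProductWith f (x ∷ xs) ys = trans (length-++ (List.map (f x) ys))
  (cong₂ _+_ (length-map (f x) ys) (length-cartesianProductWith f xs ys))

nC0≡1 : ∀ n → n C 0 ≡ 1
nC0≡1 n = trans (nCk≡nC[n∸k] {0} {n} z≤n) (nCn≡1 n)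

#zeros : ∀ {p r} → Vec (Fin (suc p)) r → ℕ
#zeros = count (Fin._≟ zero)

module _ (p : ℕ) where

  prependNonzero : ∀ {r} → List (Vec (Fin (suc p)) r) → List (Vec (Fin (suc p)) (suc r))
  prependNonzero = cartesianProductWith (λ a → suc a ∷_) (List.allFin p)

  -- Splitting on whether the first letter is zero mirrors Pascal's rule for the lengths.
  withZeros : ∀ r → ℕ → List (Vec (Fin (suc p)) r)
  withZeros zero    zero    = [] ∷ []
  withZeros zero    (suc k) = []
  withZeros (suc r) zero    = prependNonzero (withZeros r zero)
  withZeros (suc r) (suc k) = List.map (zero ∷_) (withZeros r k) ++ prependNonzero (withZeros r (suc k))

  prependNonzero-unique : ∀ {r} {ds : List (Vec (Fin (suc p)) r)} → Unique ds → Unique (prependNonzero ds)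
  prependNonzero-unique = Unique.cartesianProductWith⁺ _
    (λ { refl → refl , refl }) (Unique.allFin⁺ p)

  zero∷∉prependNonzero : ∀ {r} {ds : List (Vec (Fin (suc p)) r)} {d} → zero ∷ d ∉ prependNonzero ds
  zero∷∉prependNonzero {ds = ds} d∈ with ∈-cartesianProductWith⁻ _ (List.allFin p) ds d∈
  ... | _ , _ , _ , _ , ()

  withZeros-unique : ∀ r k → Unique (withZeros r k)
  withZeros-unique zero    zero    = [] ∷ []
  withZeros-unique zero    (suc k) = []
  withZeros-unique (suc r) zero    = prependNonzero-unique (withZeros-unique r zero)
  withZeros-unique (suc r) (suc k) = Unique.++⁺
    (Unique.map⁺ ∷-injectiveʳ (withZeros-unique r k))
    (prependNonzero-unique (withZeros-unique r (suc k)))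
    disjoint
    where
    disjoint : Disjoint (List.map (zero ∷_) (withZeros r k)) (prependNonzero (withZeros r (suc k)))
    disjoint (d∈₁ , d∈₂) with ∈-map⁻ (zero ∷_) d∈₁
    ... | _ , _ , refl = zero∷∉prependNonzero d∈₂

  #zeros-prependNonzero : ∀ {r} {ds : List (Vec (Fin (suc p)) r)} {k} → (∀ {d} → d ∈ ds → #zeros d ≡ k) →
    ∀ {d} → d ∈ prependNonzero ds → #zeros d ≡ k
  #zeros-prependNonzero {ds = ds} all d∈ with ∈-cartesianProductWith⁻ _ (List.allFin p) ds d∈
  ... | _ , _ , _ , d′∈ , refl = all d′∈

  ∈-withZeros⁻ : ∀ r k {d} → d ∈ withZeros r k → #zeros d ≡ k
  ∈-withZeros⁻ zero    zero    (here refl) = refl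
  ∈-withZeros⁻ (suc r) zero    d∈ = #zeros-prependNonzero (∈-withZeros⁻ r zero) d∈
  ∈-withZeros⁻ (suc r) (suc k) d∈ with ∈-++⁻ (List.map (zero ∷_) (withZeros r k)) d∈
  ... | inj₂ d∈₂ = #zeros-prependNonzero (∈-withZeros⁻ r (suc k)) d∈₂
  ... | inj₁ d∈₁ with ∈-map⁻ (zero ∷_) d∈₁
  ...   | _ , d′∈ , refl = cong suc (∈-withZeros⁻ r k d′∈)

  ∈-withZeros⁺ : ∀ {r} (d : Vec (Fin (suc p)) r) → d ∈ withZeros r (#zeros d)
  ∈-withZeros⁺ [] = here refl
  ∈-withZeros⁺ {suc r} (zero  ∷ d) = ∈-++⁺ˡ (∈-map⁺ (zero ∷_) (∈-withZeros⁺ d))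
  ∈-withZeros⁺ {suc r} (suc a ∷ d) = nonzero (#zeros d) (∈-withZeros⁺ d)
    where
    -- `withZeros (suc r)` reduces only once its second argument is split, so `#zeros d` is
    -- generalised to k.
    nonzero : ∀ k → d ∈ withZeros r k → suc a ∷ d ∈ withZeros (suc r) k
    nonzero zero    d∈ = ∈-cartesianProductWith⁺ (λ a → suc a ∷_) (∈-allFin a) d∈
    nonzero (suc k) d∈ = ∈-++⁺ʳ _ (∈-cartesianProductWith⁺ (λ a → suc a ∷_) (∈-allFin a) d∈)

  length-prependNonzero : ∀ {r} (ds : List (Vec (Fin (suc p)) r)) → List.length (prependNonzero ds) ≡ p * List.length ds
  length-prependNonzero ds = trans (length-cartesianProductWith _ (List.allFin p) ds)
    (cong (_* List.length ds) (length-tabulate {n = p} _))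

  length-withZeros : ∀ r k → List.length (withZeros r k) ≡ (r C k) * p ^ (r ∸ k)
  length-withZeros zero    zero    = refl
  length-withZeros zero    (suc k) = refl
  length-withZeros (suc r) zero    = begin
    List.length (prependNonzero (withZeros r 0))  ≡⟨ length-prependNonzero (withZeros r 0) ⟩
    p * List.length (withZeros r 0)               ≡⟨ cong (p *_) (length-withZeros r 0) ⟩
    p * ((r C 0) * p ^ r)                         ≡⟨ cong (λ c → p * (c * p ^ r)) (nC0≡1 r) ⟩
    p * (1 * p ^ r)                               ≡⟨ cong (p *_) (*-identityˡ (p ^ r)) ⟩
    p ^ suc r                                     ≡⟨ *-identityˡ (p ^ suc r) ⟨
    1 * p ^ suc r                                 ≡⟨ cong (_* p ^ suc r) (nC0≡1 (suc r)) ⟨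
    (suc r C 0) * p ^ suc r                       ∎
    where open ≡-Reasoning
  length-withZeros (suc r) (suc k) = begin
    List.length (List.map (zero ∷_) (withZeros r k) ++ prependNonzero (withZeros r (suc k)))
      ≡⟨ length-++ (List.map (zero ∷_) (withZeros r k)) ⟩
    List.length (List.map (zero ∷_) (withZeros r k)) + List.length (prependNonzero (withZeros r (suc k)))
      ≡⟨ cong₂ _+_ (trans (length-map (zero ∷_) (withZeros r k)) (length-withZeros r k))
           (trans (length-prependNonzero (withZeros r (suc k))) (cong (p *_) (length-withZeros r (suc k)))) ⟩
    (r C k) * p ^ (r ∸ k) + p * ((r C suc k) * p ^ (r ∸ suc k))
      ≡⟨ cong ((r C k) * p ^ (r ∸ k) +_) absorb ⟩
    (r C k) * p ^ (r ∸ k) + (r C suc k) * p ^ (r ∸ k)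
      ≡⟨ *-distribʳ-+ (p ^ (r ∸ k)) (r C k) (r C suc k) ⟨
    (r C k + r C suc k) * p ^ (r ∸ k)
      ≡⟨ cong (_* p ^ (r ∸ k)) (nCk+nC[k+1]≡[n+1]C[k+1] r k) ⟩
    (suc r C suc k) * p ^ (r ∸ k) ∎
    where
    open ≡-Reasoning
    -- For k < r the factor p raises the exponent by one. Otherwise truncated subtraction breaks
    -- this, but the binomial coefficient vanishes.
    absorb : p * ((r C suc k) * p ^ (r ∸ suc k)) ≡ (r C suc k) * p ^ (r ∸ k)
    absorb with suc k ≤? r
    ... | yes k<r = begin
      p * ((r C suc k) * p ^ (r ∸ suc k))  ≡⟨ x∙yz≈y∙xz p (r C suc k) (p ^ (r ∸ suc k)) ⟩
      (r C suc k) * p ^ suc (r ∸ suc k)    ≡⟨ cong (λ e → (r C suc k) * p ^ e) (+-∸-assoc 1 k<r) ⟨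
      (r C suc k) * p ^ (r ∸ k)            ∎
    ... | no  k≮r = begin
      p * ((r C suc k) * p ^ (r ∸ suc k))  ≡⟨ cong (λ c → p * (c * p ^ (r ∸ suc k))) rC[k+1]≡0 ⟩
      p * 0                                ≡⟨ *-zeroʳ p ⟩
      0                                    ≡⟨ cong (_* p ^ (r ∸ k)) rC[k+1]≡0 ⟨
      (r C suc k) * p ^ (r ∸ k)            ∎
      where rC[k+1]≡0 = k>n⇒nCk≡0 (≰⇒> k≮r)

  zeros-cardinality : ∀ r k → HasCardinality (λ (d : Vec (Fin (suc p)) r) → #zeros d ≡ k) ((r C k) * p ^ (r ∸ k))
  zeros-cardinality r k = withZeros r k , withZeros-unique r k
    , (λ d → mk⇔ (∈-withZeros⁻ r k) (λ { refl → ∈-withZeros⁺ d })) , length-withZeros r k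

-- Prime parking functions without the sorted rearrangement

-- In a sorted vector every entry from index i on exceeds b, so only the `toℕ i` entries before it
-- can be counted.
count-sorted : ∀ b {n} (xs : Vec ℕ n) → AllPairs _≤_ (toList xs) →
  ∀ i → b < lookup xs i → count (_≤? b) xs ≤ toℕ i
count-sorted b (x ∷ xs) (x≤xs ∷ _) zero b<x = ≤-reflexive (trans (count-toList (_≤? b) (x ∷ xs))
  (cong List.length (filter-none (_≤? b) (<⇒≱ b<x All.∷ All.map (λ x≤y → <⇒≱ (<-≤-trans b<x x≤y)) x≤xs))))
count-sorted b (x ∷ xs) (_ ∷ sorted) (suc i) b<xᵢ with x ≤ᵇ b
... | true  = s≤s (count-sorted b xs sorted i b<xᵢ)
... | false = m≤n⇒m≤1+n (count-sorted b xs sorted i b<xᵢ)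

record IsPositivePrime {m} (π : Vec ℕ (suc m)) : Set where
  field
    positive : ∀ i → 1 ≤ lookup π i
    prime    : ∀ j → 1 ≤ j → j ≤ m → suc j ≤ count (_≤? j) π

fromPrimeParkingFunction : ∀ {m} {π : Vec ℕ (suc m)} → IsPrimeParkingFunction π → IsPositivePrime π
fromPrimeParkingFunction {π = π} isPPF = record
  { positive = IsParkingFunction.positive isParkingFunction
  ; prime = λ j 1≤j j≤m → subst (suc j ≤_) (count-lookup (_≤? j) π) (prime j 1≤j j≤m) }
  where open IsPrimeParkingFunction isPPF

-- If the sorted entry at index i exceeded some b ≥ i with 1 ≤ b ≤ n - 1, at most b entries would be
-- ≤ b, against primality. Length at least 2 matters: at length 1 the prime condition is empty and
-- does not bound the entry.
toPrimeParkingFunction : ∀ {m} {π : Vec ℕ (2+ m)} → IsPositivePrime π → IsPrimeParkingFunction π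
toPrimeParkingFunction {m} {π} isPP = record
  { isParkingFunction = record
    { positive = positive
    ; rearrangement = λs
    ; permuted = permuted
    ; increasing = increasing
    ; bounded = bounded }
  ; prime = λ j 1≤j j≤m → subst (suc j ≤_) (sym (count-lookup (_≤? j) π)) (prime j 1≤j j≤m) }
  where
  open IsPositivePrime isPP
  open ≤-Reasoning
  length-sort : List.length (sort (toList π)) ≡ 2+ m
  length-sort = trans (↭-length (sort-↭ (toList π))) (length-toList π)
  λs : Vec ℕ (2+ m)
  λs = Vec.cast length-sort (fromList (sort (toList π)))
  toList-λs : toList λs ≡ sort (toList π)
  toList-λs = trans (toList-cast length-sort (fromList (sort (toList π)))) (toList∘fromList _)
  permuted : toList λs ↭ toList π
  permuted = subst (_↭ toList π) (sym toList-λs) (sort-↭ (toList π))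
  increasing : Sorted (toList λs)
  increasing = subst Sorted (sym toList-λs) (sort-↗ (toList π))
  few-below : ∀ i b → 1 ≤ b → b ≤ suc m → toℕ i ≤ b → ¬ b < lookup λs i
  few-below i b 1≤b b≤1+m i≤b b<λᵢ = contradiction (begin-strict
    b                   <⟨ prime b 1≤b b≤1+m ⟩
    count (_≤? b) π     ≡⟨ count-↭ (_≤? b) λs π permuted ⟨
    count (_≤? b) λs    ≤⟨ count-sorted b λs (Sorted⇒AllPairs ≤-totalOrder increasing) i b<λᵢ ⟩
    toℕ i               ≤⟨ i≤b ⟩
    b                   ∎) (n≮n b)
  bounded : ∀ i → lookup λs i ≤ position i
  bounded i with suc (toℕ i) ≤? suc m
  ... | yes 1+i≤1+m = ≮⇒≥ (few-below i (suc (toℕ i)) (s≤s z≤n) 1+i≤1+m (n≤1+n (toℕ i)))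
  -- At the last position n primality says nothing about b = n, so b = n - 1 is used.
  ... | no  i≮1+m = ≮⇒≥ (λ i<λᵢ → few-below i (suc m) (s≤s z≤n) ≤-refl (s≤s⁻¹ (Fin.toℕ<n i))
          (<-trans (≰⇒> i≮1+m) i<λᵢ))

-- The cycle lemma

module Cyclic (p : ℕ) where

  m : ℕ
  m = suc p

  toℕ-mod : ∀ x → toℕ (x mod m) ≡ x % m
  toℕ-mod x = Fin.toℕ-fromℕ< (m%n<n x m)

  toℕ%m : ∀ (a : Fin m) → toℕ a % m ≡ toℕ a
  toℕ%m a = m<n⇒m%n≡m (Fin.toℕ<n a)

  mod-toℕ : ∀ a → toℕ a mod m ≡ a
  mod-toℕ a = Fin.toℕ-injective (trans (toℕ-mod (toℕ a)) (toℕ%m a))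

  infixl 6 _⊕_

  -- Opaque, so that goals mention `_⊕_` and `neg` and do not unfold to `_mod_`.
  abstract
    _⊕_ : Fin m → Fin m → Fin m
    a ⊕ b = (toℕ a + toℕ b) mod m

    -- The reduction matters at zero, where m ∸ 0 = m must return to 0.
    neg : Fin m → Fin m
    neg a = (m ∸ toℕ a) mod m

    toℕ-⊕ : ∀ a b → toℕ (a ⊕ b) ≡ (toℕ a + toℕ b) % m
    toℕ-⊕ a b = toℕ-mod (toℕ a + toℕ b)

    -- Reduction modulo m is additive, so the group laws can be read off from ℕ.
    ⊕-mod : ∀ x y → x mod m ⊕ y mod m ≡ (x + y) mod m
    ⊕-mod x y = Fin.toℕ-injective (begin
      toℕ (x mod m ⊕ y mod m)              ≡⟨ toℕ-mod (toℕ (x mod m) + toℕ (y mod m)) ⟩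
      (toℕ (x mod m) + toℕ (y mod m)) % m  ≡⟨ cong₂ (λ a b → (a + b) % m) (toℕ-mod x) (toℕ-mod y) ⟩
      (x % m + y % m) % m                  ≡⟨ %-distribˡ-+ x y m ⟨
      (x + y) % m                          ≡⟨ toℕ-mod (x + y) ⟨
      toℕ ((x + y) mod m)                  ∎)
      where open ≡-Reasoning

    ⊕-comm : ∀ a b → a ⊕ b ≡ b ⊕ a
    ⊕-comm a b = cong (_mod m) (+-comm (toℕ a) (toℕ b))

    ⊕-assoc : ∀ a b c → (a ⊕ b) ⊕ c ≡ a ⊕ (b ⊕ c)
    ⊕-assoc a b c = begin
      (a ⊕ b) ⊕ c                                  ≡⟨ cong ((a ⊕ b) ⊕_) (mod-toℕ c) ⟨
      (a ⊕ b) ⊕ toℕ c mod m                        ≡⟨ ⊕-mod (toℕ a + toℕ b) (toℕ c) ⟩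
      (toℕ a + toℕ b + toℕ c) mod m                ≡⟨ cong (_mod m) (+-assoc (toℕ a) (toℕ b) (toℕ c)) ⟩
      (toℕ a + (toℕ b + toℕ c)) mod m              ≡⟨ ⊕-mod (toℕ a) (toℕ b + toℕ c) ⟨
      toℕ a mod m ⊕ (b ⊕ c)                        ≡⟨ cong (_⊕ (b ⊕ c)) (mod-toℕ a) ⟩
      a ⊕ (b ⊕ c)                                  ∎
      where open ≡-Reasoning

    ⊕-identityˡ : ∀ a → zero ⊕ a ≡ a
    ⊕-identityˡ = mod-toℕ

    ⊕-inverseʳ : ∀ a → a ⊕ neg a ≡ zero
    ⊕-inverseʳ a = begin
      a ⊕ neg a                        ≡⟨ cong (_⊕ neg a) (mod-toℕ a) ⟨
      toℕ a mod m ⊕ (m ∸ toℕ a) mod m  ≡⟨ ⊕-mod (toℕ a) (m ∸ toℕ a) ⟩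
      (toℕ a + (m ∸ toℕ a)) mod m      ≡⟨ cong (_mod m) (m+[n∸m]≡n (Fin.toℕ≤n a)) ⟩
      m mod m                          ≡⟨ Fin.toℕ-injective (trans (toℕ-mod m) (n%n≡0 m)) ⟩
      zero                             ∎
      where open ≡-Reasoning

  ⊕-abelianGroup : AbelianGroup 0ℓ 0ℓ
  ⊕-abelianGroup = record
    { _∙_ = _⊕_ ; ε = zero ; _⁻¹ = neg
    ; isAbelianGroup = record
      { isGroup = record
        { isMonoid = record
          { isSemigroup = record
            { isMagma = record { isEquivalence = isEquivalence ; ∙-cong = cong₂ _⊕_ }
            ; assoc = ⊕-assoc }
          ; identity = ⊕-identityˡ , λ a → trans (⊕-comm a zero) (⊕-identityˡ a) }
        ; inverse = (λ a → trans (⊕-comm (neg a) a) (⊕-inverseʳ a)) , ⊕-inverseʳ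
        ; ⁻¹-cong = cong neg }
      ; comm = ⊕-comm } }

-- s is the last point of [0, M] where F t − t is minimal, with both sides moved
-- so that no subtraction occurs. For F = #below x it is the s with x ⊖ s prime.
record IsLastMin (F : ℕ → ℕ) (M s : ℕ) : Set where
  field
    bound  : s ≤ M
    before : ∀ t → t ≤ s → F s + t ≤ F t + s
    after  : ∀ t → s < t → t ≤ M → F s + t < F t + s

-- Induction on M: the new endpoint replaces the old minimum unless its value is strictly larger, so
-- ties go to the later point.
lastMin : ∀ F M → ∃[ s ] IsLastMin F M s
lastMin F zero = 0 , record
  { bound  = z≤n
  ; before = λ { .0 z≤n → ≤-refl }
  ; after  = λ t 0<t t≤0 → contradiction (<-≤-trans 0<t t≤0) (n≮n 0) }
lastMin F (suc M) with lastMin F M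
... | s , min with F s + suc M <? F (suc M) + s
...   | yes F[s]<F[M+1] = s , record
  { bound  = m≤n⇒m≤1+n bound
  ; before = before
  ; after  = after′ }
  where
  open IsLastMin min
  after′ : ∀ t → s < t → t ≤ suc M → F s + t < F t + s
  after′ t s<t t≤M+1 with m≤n⇒m<n∨m≡n t≤M+1
  ... | inj₁ (s≤s t≤M) = after t s<t t≤M
  ... | inj₂ refl      = F[s]<F[M+1]
...   | no F[s]≮F[M+1] = suc M , record
  { bound  = ≤-refl
  ; before = before′
  ; after  = λ t M+1<t t≤M+1 → contradiction (<-≤-trans M+1<t t≤M+1) (n≮n (suc M)) }
  where
  open IsLastMin min
  F[s]≤ : ∀ t → t ≤ M → F s + t ≤ F t + s
  F[s]≤ t t≤M with t ≤? s
  ... | yes t≤s = before t t≤s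
  ... | no  t≰s = <⇒≤ (after t (≰⇒> t≰s) t≤M)
  before′ : ∀ t → t ≤ suc M → F (suc M) + t ≤ F t + suc M
  before′ t t≤M+1 with m≤n⇒m<n∨m≡n t≤M+1
  ... | inj₂ refl      = ≤-refl
  -- Transitivity through s: the comparisons of M + 1 with s and of s with t are added, and
  -- `F s + s` cancels.
  ... | inj₁ (s≤s t≤M) = +-cancelʳ-≤ (F s + s) _ _ (begin
    F (suc M) + t + (F s + s)      ≡⟨ exchange (F (suc M)) t (F s) s ⟩
    (F (suc M) + s) + (F s + t)    ≤⟨ +-mono-≤ (≮⇒≥ F[s]≮F[M+1]) (F[s]≤ t t≤M) ⟩
    (F s + suc M) + (F t + s)      ≡⟨ exchange′ (F s) (suc M) (F t) s ⟩
    F t + suc M + (F s + s)        ∎)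
    where
    open ≤-Reasoning
    exchange : ∀ a b c d → a + b + (c + d) ≡ (a + d) + (c + b)
    exchange = solve-∀
    exchange′ : ∀ a b c d → (a + b) + (c + d) ≡ c + b + (a + d)
    exchange′ = solve-∀

-- Of two candidates the earlier would be strictly below the later, while the later is at most the
-- earlier.
lastMin-unique : ∀ {F M s s′} → IsLastMin F M s → IsLastMin F M s′ → s ≡ s′
lastMin-unique {s = s} {s′} min min′ with <-cmp s s′
... | tri≈ _ s≡s′ _ = s≡s′
... | tri< s<s′ _ _ = contradiction (IsLastMin.after min _ s<s′ (IsLastMin.bound min′))
                                    (≤⇒≯ (IsLastMin.before min′ _ (<⇒≤ s<s′)))
... | tri> _ _ s′<s = contradiction (IsLastMin.after min′ _ s′<s (IsLastMin.bound min))
                                    (≤⇒≯ (IsLastMin.before min _ (<⇒≤ s′<s)))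

-- Shifting a word over ℤ/m to a prime one

module _ (p : ℕ) where
  open Cyclic p
  open AbelianGroup ⊕-abelianGroup using (group) renaming (_-_ to _⊖_)
  open Algebra.Properties.Group group using (//-rightDividesˡ)

  -- Letters start at 0, so `toℕ a < j` unfolds to `position a ≤ j`: this is the count in the prime
  -- condition.
  #below : ∀ {n} → (Fin n → Fin m) → ℕ → ℕ
  #below x j = sum (λ i → ⟦ toℕ (x i) <? j ⟧)

  #below-all : ∀ {n} (x : Fin n → Fin m) → #below x m ≡ n
  #below-all {n} x = trans (sum-cong-≗ (λ i → ⟦⟧-yes (toℕ (x i) <? m) (Fin.toℕ<n (x i)))) (sum-ones n)

  #below-0 : ∀ {n} (x : Fin n → Fin m) → #below x 0 ≡ 0
  #below-0 {n} x = trans (sum-cong-≗ (λ i → ⟦⟧-no (toℕ (x i) <? 0) n≮0)) (sum-zeros n)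

  -- The sum on the left is congruent to a modulo m and less than 2m.
  ⊖-split : ∀ a s → toℕ (a ⊖ s) + toℕ s ≡ toℕ a ⊎ toℕ (a ⊖ s) + toℕ s ≡ m + toℕ a
  ⊖-split a s with toℕ (a ⊖ s) + toℕ s <? m
                 | trans (sym (toℕ-⊕ (a ⊖ s) s)) (cong toℕ (//-rightDividesˡ s a))
  ... | yes x+s<m | eq = inj₁ (trans (sym (m<n⇒m%n≡m x+s<m)) eq)
  ... | no  x+s≮m | eq = inj₂ (begin
    x+s               ≡⟨ m+[n∸m]≡n m≤x+s ⟨
    m + (x+s ∸ m)     ≡⟨ cong (m +_) (m<n⇒m%n≡m x+s∸m<m) ⟨
    m + (x+s ∸ m) % m ≡⟨ cong (m +_) (m≤n⇒[n∸m]%m≡n%m m≤x+s) ⟩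
    m + x+s % m       ≡⟨ cong (m +_) eq ⟩
    m + toℕ a         ∎)
    where
    open ≡-Reasoning
    x+s = toℕ (a ⊖ s) + toℕ s
    m≤x+s = ≮⇒≥ x+s≮m
    x+s∸m<m : x+s ∸ m < m
    x+s∸m<m = +-cancelˡ-< m _ _ (subst (_< m + m) (sym (m+[n∸m]≡n m≤x+s))
                (+-mono-< (Fin.toℕ<n (a ⊖ s)) (Fin.toℕ<n s)))

  -- `a ⊖ s` is below j exactly when a lies in the cyclic interval of j residues starting at s. Here
  -- it does not wrap, and [0, s) together with [s, s + j) is [0, s + j).
  ⟦⊖⟧-unwrapped : ∀ a s j → toℕ s + j ≤ m →
    ⟦ toℕ (a ⊖ s) <? j ⟧ + ⟦ toℕ a <? toℕ s ⟧ ≡ ⟦ toℕ a <? toℕ s + j ⟧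
  ⟦⊖⟧-unwrapped a s j s+j≤m with ⊖-split a s
  ... | inj₁ x+s≡a = begin
    ⟦ x <? j ⟧ + ⟦ toℕ a <? toℕ s ⟧  ≡⟨ cong (⟦ x <? j ⟧ +_) (⟦⟧-no (toℕ a <? toℕ s) (≤⇒≯ s≤a)) ⟩
    ⟦ x <? j ⟧ + 0                   ≡⟨ +-identityʳ _ ⟩
    ⟦ x <? j ⟧                       ≡⟨ ⟦⟧-cong (x <? j) (toℕ a <? toℕ s + j) to from ⟩
    ⟦ toℕ a <? toℕ s + j ⟧           ∎
    where
    open ≡-Reasoning
    x = toℕ (a ⊖ s)
    s+x≡a = trans (+-comm (toℕ s) x) x+s≡a
    s≤a : toℕ s ≤ toℕ a
    s≤a = subst (toℕ s ≤_) x+s≡a (m≤n+m (toℕ s) x)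
    to : x < j → toℕ a < toℕ s + j
    to x<j = subst (_< toℕ s + j) s+x≡a (+-monoʳ-< (toℕ s) x<j)
    from : toℕ a < toℕ s + j → x < j
    from a<s+j = +-cancelˡ-< (toℕ s) x j (subst (_< toℕ s + j) (sym s+x≡a) a<s+j)
  ... | inj₂ x+s≡m+a = begin
    ⟦ x <? j ⟧ + ⟦ toℕ a <? toℕ s ⟧  ≡⟨ cong₂ _+_ (⟦⟧-no (x <? j) (≤⇒≯ j≤x)) (⟦⟧-yes (toℕ a <? toℕ s) a<s) ⟩
    1                                ≡⟨ ⟦⟧-yes (toℕ a <? toℕ s + j) (<-≤-trans a<s (m≤m+n (toℕ s) j)) ⟨
    ⟦ toℕ a <? toℕ s + j ⟧           ∎
    where
    open ≡-Reasoning
    x = toℕ (a ⊖ s)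
    s+x≡m+a = trans (+-comm (toℕ s) x) x+s≡m+a
    j≤x : j ≤ x
    j≤x = +-cancelˡ-≤ (toℕ s) j x (≤-trans s+j≤m (subst (m ≤_) (sym s+x≡m+a) (m≤m+n m (toℕ a))))
    a<s : toℕ a < toℕ s
    a<s = +-cancelˡ-< m _ _ (subst (_< m + toℕ s) x+s≡m+a (+-monoˡ-< (toℕ s) (Fin.toℕ<n (a ⊖ s))))

  -- Now the interval is [s, m) together with [0, t); adding [0, s) covers every residue once and
  -- [0, t) once more.
  ⟦⊖⟧-wrapped : ∀ a s j t → toℕ s + j ≡ m + t → t ≤ toℕ s →
    ⟦ toℕ (a ⊖ s) <? j ⟧ + ⟦ toℕ a <? toℕ s ⟧ ≡ 1 + ⟦ toℕ a <? t ⟧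
  ⟦⊖⟧-wrapped a s j t s+j≡m+t t≤s with ⊖-split a s
  ... | inj₁ x+s≡a = trans
    (cong₂ _+_ (⟦⟧-yes (x <? j) x<j) (⟦⟧-no (toℕ a <? toℕ s) (≤⇒≯ s≤a)))
    (sym (cong suc (⟦⟧-no (toℕ a <? t) (≤⇒≯ (≤-trans t≤s s≤a)))))
    where
    x = toℕ (a ⊖ s)
    s+x≡a = trans (+-comm (toℕ s) x) x+s≡a
    s≤a : toℕ s ≤ toℕ a
    s≤a = subst (toℕ s ≤_) x+s≡a (m≤n+m (toℕ s) x)
    x<j : x < j
    x<j = +-cancelˡ-< (toℕ s) x j (subst₂ _<_ (sym s+x≡a) (sym s+j≡m+t)
            (<-≤-trans (Fin.toℕ<n a) (m≤m+n m t)))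
  ... | inj₂ x+s≡m+a = begin
    ⟦ x <? j ⟧ + ⟦ toℕ a <? toℕ s ⟧  ≡⟨ cong (⟦ x <? j ⟧ +_) (⟦⟧-yes (toℕ a <? toℕ s) a<s) ⟩
    ⟦ x <? j ⟧ + 1                   ≡⟨ +-comm ⟦ x <? j ⟧ 1 ⟩
    1 + ⟦ x <? j ⟧                   ≡⟨ cong suc (⟦⟧-cong (x <? j) (toℕ a <? t) to from) ⟩
    1 + ⟦ toℕ a <? t ⟧               ∎
    where
    open ≡-Reasoning
    x = toℕ (a ⊖ s)
    s+x≡m+a = trans (+-comm (toℕ s) x) x+s≡m+a
    a<s : toℕ a < toℕ s
    a<s = +-cancelˡ-< m _ _ (subst (_< m + toℕ s) x+s≡m+a (+-monoˡ-< (toℕ s) (Fin.toℕ<n (a ⊖ s))))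
    to : x < j → toℕ a < t
    to x<j = +-cancelˡ-< m _ _ (subst₂ _<_ s+x≡m+a s+j≡m+t (+-monoʳ-< (toℕ s) x<j))
    from : toℕ a < t → x < j
    from a<t = +-cancelˡ-< (toℕ s) x j (subst₂ _<_ (sym s+x≡m+a) (sym s+j≡m+t) (+-monoʳ-< m a<t))

  module _ {n} (x : Fin n → Fin m) (s : Fin m) where

    #below-unwrapped : ∀ j → toℕ s + j ≤ m →
      #below (λ i → x i ⊖ s) j + #below x (toℕ s) ≡ #below x (toℕ s + j)
    #below-unwrapped j s+j≤m = trans
      (sym (∑-distrib-+ (λ i → ⟦ toℕ (x i ⊖ s) <? j ⟧) (λ i → ⟦ toℕ (x i) <? toℕ s ⟧)))
      (sum-cong-≗ (λ i → ⟦⊖⟧-unwrapped (x i) s j s+j≤m))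

    #below-wrapped : ∀ j t → toℕ s + j ≡ m + t → t ≤ toℕ s →
      #below (λ i → x i ⊖ s) j + #below x (toℕ s) ≡ n + #below x t
    #below-wrapped j t s+j≡m+t t≤s = begin
      #below (λ i → x i ⊖ s) j + #below x (toℕ s)   ≡⟨ ∑-distrib-+ (λ i → ⟦ toℕ (x i ⊖ s) <? j ⟧) (λ i → ⟦ toℕ (x i) <? toℕ s ⟧) ⟨
      sum (λ i → ⟦ toℕ (x i ⊖ s) <? j ⟧ + ⟦ toℕ (x i) <? toℕ s ⟧)
                                                    ≡⟨ sum-cong-≗ (λ i → ⟦⊖⟧-wrapped (x i) s j t s+j≡m+t t≤s) ⟩
      sum (λ i → 1 + ⟦ toℕ (x i) <? t ⟧)            ≡⟨ ∑-distrib-+ (λ _ → 1) (λ i → ⟦ toℕ (x i) <? t ⟧) ⟩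
      sum {n} (λ _ → 1) + #below x t                ≡⟨ cong (_+ #below x t) (sum-ones n) ⟩
      n + #below x t                                ∎
      where open ≡-Reasoning

  Prime : (Fin (suc m) → Fin m) → Set
  Prime x = ∀ j → 1 ≤ j → j ≤ m → suc j ≤ #below x j

  module _ (x : Fin (suc m) → Fin m) (s : Fin m) where
    private
      x⊖s : Fin (suc m) → Fin m
      x⊖s i = x i ⊖ s
      F = #below x
      S = toℕ s

    -- The prime bound at j compares S with the point S + j taken modulo m. Up to m this is the
    -- strict inequality; past m, one full turn adds m + 1 letters against m steps, and this surplus
    -- of one makes it weak.
    prime⇒lastMin : Prime x⊖s → IsLastMin F m S
    prime⇒lastMin prime = record { bound = Fin.toℕ≤n s ; before = before ; after = after }
      where
      open ≤-Reasoning
      rearrange : ∀ c s j → suc (c + (s + j)) ≡ suc j + c + s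
      rearrange = solve-∀
      after : ∀ t → S < t → t ≤ m → F S + t < F t + S
      after t S<t t≤m with m≤n⇒∃[o]m+o≡n (<⇒≤ S<t)
      ... | j , refl = begin
        suc (F S + (S + j))    ≡⟨ rearrange (F S) S j ⟩
        suc j + F S + S        ≤⟨ +-monoˡ-≤ S (+-monoˡ-≤ (F S) (prime j 0<j j≤m)) ⟩
        #below x⊖s j + F S + S ≡⟨ cong (_+ S) (#below-unwrapped x s j t≤m) ⟩
        F (S + j) + S          ∎
        where
        0<j : 0 < j
        0<j = +-cancelˡ-< S 0 j (subst (_< S + j) (sym (+-identityʳ S)) S<t)
        j≤m = ≤-trans (m≤n+m j S) t≤m
      rearrange₂ : ∀ c m t → suc m + (c + t) ≡ suc (m + t) + c
      rearrange₂ = solve-∀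
      rearrange₃ : ∀ c s j → suc (s + j) + c ≡ suc j + c + s
      rearrange₃ = solve-∀
      before : ∀ t → t ≤ S → F S + t ≤ F t + S
      before t t≤S = +-cancelˡ-≤ (suc m) _ _ (begin
        suc m + (F S + t)      ≡⟨ rearrange₂ (F S) m t ⟩
        suc (m + t) + F S      ≡⟨ cong (λ z → suc z + F S) S+j≡m+t ⟨
        suc (S + j) + F S      ≡⟨ rearrange₃ (F S) S j ⟩
        suc j + F S + S        ≤⟨ +-monoˡ-≤ S (+-monoˡ-≤ (F S) (prime j 0<j j≤m)) ⟩
        #below x⊖s j + F S + S ≡⟨ cong (_+ S) (#below-wrapped x s j t S+j≡m+t t≤S) ⟩
        suc m + F t + S        ≡⟨ +-assoc (suc m) (F t) S ⟩
        suc m + (F t + S)      ∎)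
        where
        -- The number of steps from S up to m and on to t: positive since S < m, at most m since t ≤
        -- S.
        j = m ∸ S + t
        S+j≡m+t : S + j ≡ m + t
        S+j≡m+t = trans (sym (+-assoc S (m ∸ S) t)) (cong (_+ t) (m+[n∸m]≡n (Fin.toℕ≤n s)))
        0<j : 0 < j
        0<j = <-≤-trans (m<n⇒0<n∸m (Fin.toℕ<n s)) (m≤m+n (m ∸ S) t)
        j≤m : j ≤ m
        j≤m = ≤-trans (+-monoʳ-≤ (m ∸ S) t≤S) (≤-reflexive (m∸n+n≡m (Fin.toℕ≤n s)))

    -- The same correspondence backwards: j gives the point S + j when that is at most m, and its
    -- excess over m otherwise.
    lastMin⇒prime : IsLastMin F m S → Prime x⊖s
    lastMin⇒prime min j 0<j j≤m = +-cancelʳ-≤ (F S + S) _ _ core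
      where
      open IsLastMin min
      open ≤-Reasoning
      rearrange : ∀ c s j → suc j + (c + s) ≡ suc (c + (s + j))
      rearrange = solve-∀
      rearrange₂ : ∀ c m t → suc (c + (m + t)) ≡ suc m + (c + t)
      rearrange₂ = solve-∀
      core : suc j + (F S + S) ≤ #below x⊖s j + (F S + S)
      core with S + j ≤? m
      ... | yes S+j≤m = begin
        suc j + (F S + S)        ≡⟨ rearrange (F S) S j ⟩
        suc (F S + (S + j))      ≤⟨ after (S + j) (m<m+n S 0<j) S+j≤m ⟩
        F (S + j) + S            ≡⟨ cong (_+ S) (#below-unwrapped x s j S+j≤m) ⟨
        #below x⊖s j + F S + S   ≡⟨ +-assoc (#below x⊖s j) (F S) S ⟩
        #below x⊖s j + (F S + S) ∎
      ... | no S+j≰m with m≤n⇒∃[o]m+o≡n (<⇒≤ (≰⇒> S+j≰m))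
      ...   | t , m+t≡S+j = begin
        suc j + (F S + S)        ≡⟨ rearrange (F S) S j ⟩
        suc (F S + (S + j))      ≡⟨ cong (λ z → suc (F S + z)) m+t≡S+j ⟨
        suc (F S + (m + t))      ≡⟨ rearrange₂ (F S) m t ⟩
        suc m + (F S + t)        ≤⟨ +-monoʳ-≤ (suc m) (before t t≤S) ⟩
        suc m + (F t + S)        ≡⟨ +-assoc (suc m) (F t) S ⟨
        suc m + F t + S          ≡⟨ cong (_+ S) (#below-wrapped x s j t (sym m+t≡S+j) t≤S) ⟨
        #below x⊖s j + F S + S   ≡⟨ +-assoc (#below x⊖s j) (F S) S ⟩
        #below x⊖s j + (F S + S) ∎
        where
        t≤S : t ≤ S
        t≤S = +-cancelˡ-≤ m t S (≤-trans (≤-reflexive (trans m+t≡S+j (+-comm S j))) (+-monoˡ-≤ S j≤m))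

  abstract
    -- Existence in the cycle lemma: the shift is the last minimum of `#below x t` - t on [0, m].
    primeShift : (x : Fin (suc m) → Fin m) → ∃[ s ] Prime (λ i → x i ⊖ s)
    primeShift x with lastMin (#below x) m
    ... | s , min with s <? m
    ...   | yes s<m = s mod m , lastMin⇒prime x (s mod m)
              (subst (IsLastMin _ m) (sym (trans (toℕ-mod s) (m<n⇒m%n≡m s<m))) min)
    -- The last minimum is not at m: all m + 1 letters are below m, so the value there is 1, while
    -- at 0 it is 0.
    ...   | no  s≮m = contradiction (begin-strict
      m                ≡⟨ s≡m ⟨
      s                <⟨ n<1+n s ⟩
      suc s            ≡⟨ cong suc s≡m ⟩
      suc m            ≡⟨ #below-all x ⟨
      #below x m       ≡⟨ cong (#below x) s≡m ⟨
      #below x s       ≡⟨ +-identityʳ (#below x s) ⟨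
      #below x s + 0   ≤⟨ IsLastMin.before min 0 z≤n ⟩
      #below x 0 + s   ≡⟨ cong₂ _+_ (#below-0 x) s≡m ⟩
      m                ∎) (n≮n m)
      where
      open ≤-Reasoning
      s≡m : s ≡ m
      s≡m = ≤-antisym (IsLastMin.bound min) (≮⇒≥ s≮m)

  primeShift-unique : ∀ x {s s′} → Prime (λ i → x i ⊖ s) → Prime (λ i → x i ⊖ s′) → s ≡ s′
  primeShift-unique x {s} {s′} prime prime′ =
    Fin.toℕ-injective (lastMin-unique (prime⇒lastMin x s prime) (prime⇒lastMin x s′ prime′))

-- Rotating positions and shifting values

module _ (p : ℕ) where
  open Cyclic p
  open AbelianGroup ⊕-abelianGroup using (group) renaming (_-_ to _⊖_)
  open Algebra.Properties.Group group
    using (//-rightDividesˡ; //-rightDividesʳ; ⁻¹-involutive; ⁻¹-injective; ∙-cancelʳ; identityˡ-unique)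

  rotation : Fin m → Permutation′ m
  rotation s = permutation (_⊕ s) (_⊖ s) (//-rightDividesˡ s) (//-rightDividesʳ s)

  -- The representative with last entry 0, that entry moved to the front.
  displaced : Vec (Fin m) m → Fin (suc m) → Fin m
  displaced d zero    = zero
  displaced d (suc i) = lookup d i ⊕ i

  -- The representative has letter `lookup d (i ⊕ s) ⊕ (i ⊕ s)` at `i ⊕ s`; lowering it by s leaves
  -- this form, which equals i exactly when the letter of d is zero.
  front : Vec (Fin m) m → Fin m → Fin m → Fin m
  front d s i = lookup d (i ⊕ s) ⊕ i

  -- The last position is not rotated; its letter 0 is lowered by s to `neg s`.
  rotated : Vec (Fin m) m → Fin m → Vec (Fin m) (suc m)
  rotated d s = tabulate (front d s) ∷ʳ neg s

  -- Rotating positions only permutes the summands, so the entries are those of `displaced d`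
  -- lowered by s, up to order.
  count-rotated : ∀ {P : Fin m → Set} (P? : Decidable P) d s →
    count P? (rotated d s) ≡ sum (λ i → ⟦ P? (displaced d i ⊖ s) ⟧)
  count-rotated P? d s = begin
    count P? (rotated d s)
      ≡⟨ count-∷ʳ P? (tabulate (front d s)) (neg s) ⟩
    ⟦ P? (neg s) ⟧ + count P? (tabulate (front d s))
      ≡⟨ cong₂ _+_ (cong (λ a → ⟦ P? a ⟧) (sym (⊕-identityˡ (neg s))))
           (trans (count-tabulate P? (front d s)) (sum-cong-≗ shift)) ⟩
    ⟦ P? (zero ⊖ s) ⟧ + sum (λ i → ⟦ P? (displaced d (suc (i ⊕ s)) ⊖ s) ⟧)
      ≡⟨ cong (⟦ P? (zero ⊖ s) ⟧ +_) (sum-permute (λ i → ⟦ P? (displaced d (suc i) ⊖ s) ⟧) (rotation s)) ⟨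
    sum (λ i → ⟦ P? (displaced d i ⊖ s) ⟧) ∎
    where
    open ≡-Reasoning
    shift : ∀ i → ⟦ P? (lookup d (i ⊕ s) ⊕ i) ⟧ ≡ ⟦ P? (displaced d (suc (i ⊕ s)) ⊖ s) ⟧
    shift i = cong (λ a → ⟦ P? a ⟧) (begin
      lookup d (i ⊕ s) ⊕ i             ≡⟨ //-rightDividesʳ s (lookup d (i ⊕ s) ⊕ i) ⟨
      lookup d (i ⊕ s) ⊕ i ⊕ s ⊖ s     ≡⟨ cong (_⊖ s) (⊕-assoc (lookup d (i ⊕ s)) i s) ⟩
      lookup d (i ⊕ s) ⊕ (i ⊕ s) ⊖ s   ∎)

  -- The last entry `neg s` recovers the shift, after which the front entries determine d. The
  -- shifts may differ a priori because `primeRotation` lets them depend on d.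
  rotated-injective : ∀ {d d′ s s′} → rotated d s ≡ rotated d′ s′ → d ≡ d′
  rotated-injective {d} {d′} {s} {s′} eq with ∷ʳ-injective (tabulate (front d s)) (tabulate (front d′ s′)) eq
  ... | eq₁ , eq₂ with ⁻¹-injective {s} {s′} eq₂
  ... | refl = lookup-ext λ i → subst (λ i → lookup d i ≡ lookup d′ i) (//-rightDividesˡ s i) (rotated-eq (i ⊖ s))
    where
    open ≡-Reasoning
    rotated-eq : ∀ i → lookup d (i ⊕ s) ≡ lookup d′ (i ⊕ s)
    rotated-eq i = ∙-cancelʳ i (lookup d (i ⊕ s)) (lookup d′ (i ⊕ s)) (begin
      lookup d (i ⊕ s) ⊕ i              ≡⟨ lookup∘tabulate (front d s) i ⟨
      lookup (tabulate (front d s)) i   ≡⟨ cong (λ xs → lookup xs i) eq₁ ⟩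
      lookup (tabulate (front d′ s)) i  ≡⟨ lookup∘tabulate (front d′ s) i ⟩
      lookup d′ (i ⊕ s) ⊕ i             ∎)

  rotated-surjective : ∀ ys → ∃₂ λ d s → rotated d s ≡ ys
  rotated-surjective ys with initLast ys
  ... | xs , x , refl = d , s , cong₂ _∷ʳ_ (lookup-ext {xs = tabulate (front d s)} {xs} eq) (⁻¹-involutive x)
    where
    open ≡-Reasoning
    -- The last entry must be `neg s`, which forces s; solving the equation for `front` at index
    -- `i ⊖ s` then forces `f`.
    s = neg x
    f = λ i → lookup xs (i ⊖ s) ⊖ (i ⊖ s)
    d = tabulate f
    eq : ∀ i → lookup (tabulate (front d s)) i ≡ lookup xs i
    eq i = begin
      lookup (tabulate (front d s)) i                     ≡⟨ lookup∘tabulate (front d s) i ⟩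
      lookup d (i ⊕ s) ⊕ i                                ≡⟨ cong (_⊕ i) (lookup∘tabulate f (i ⊕ s)) ⟩
      lookup xs (i ⊕ s ⊖ s) ⊖ (i ⊕ s ⊖ s) ⊕ i             ≡⟨ cong (λ j → lookup xs j ⊖ j ⊕ i) (//-rightDividesʳ s i) ⟩
      lookup xs i ⊖ i ⊕ i                                 ≡⟨ //-rightDividesˡ i (lookup xs i) ⟩
      lookup xs i                                         ∎

  count-position : ∀ d s j → count (_≤? j) (map position (rotated d s)) ≡ #below p (λ i → displaced d i ⊖ s) j
  count-position d s j = trans (count-map (_≤? j) position (rotated d s))
    (count-rotated (λ a → position a ≤? j) d s)

  prime⇒positivePrime : ∀ d s → Prime p (λ i → displaced d i ⊖ s) → IsPositivePrime (map position (rotated d s))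
  prime⇒positivePrime d s prime = record
    { positive = λ i → subst (1 ≤_) (sym (lookup-map i position (rotated d s))) (s≤s z≤n)
    ; prime    = λ j 1≤j j≤m → subst (suc j ≤_) (sym (count-position d s j)) (prime j 1≤j j≤m) }

  positivePrime⇒prime : ∀ d s → IsPositivePrime (map position (rotated d s)) → Prime p (λ i → displaced d i ⊖ s)
  positivePrime⇒prime d s isPP j 1≤j j≤m =
    subst (suc j ≤_) (count-position d s j) (IsPositivePrime.prime isPP j 1≤j j≤m)

  -- A front position i is fixed exactly when d vanishes at `i ⊕ s`, and rotation reindexes the
  -- zeros. The last position is m + 1, whereas entries are at most m.
  #fixedPoints-rotated : ∀ d s → #fixedPoints (map position (rotated d s)) ≡ #zeros d
  #fixedPoints-rotated d s = begin
    #fixedPoints π                                  ≡⟨ count-tabulate fixed? (λ i → i) ⟩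
    sum (λ i → ⟦ fixed? i ⟧)                        ≡⟨ sum-init-last (λ i → ⟦ fixed? i ⟧) ⟩
    sum (λ i → ⟦ fixed? (inject₁ i) ⟧) + ⟦ fixed? (fromℕ m) ⟧
      ≡⟨ cong₂ _+_ (sum-cong-≗ (λ i → ⟦⟧-cong (fixed? (inject₁ i)) (lookup d (i ⊕ s) Fin.≟ zero) (to i) (from i)))
           (⟦⟧-no (fixed? (fromℕ m)) last-unfixed) ⟩
    sum (λ i → ⟦ lookup d (i ⊕ s) Fin.≟ zero ⟧) + 0  ≡⟨ +-identityʳ _ ⟩
    sum (λ i → ⟦ lookup d (i ⊕ s) Fin.≟ zero ⟧)      ≡⟨ sum-permute (λ i → ⟦ lookup d i Fin.≟ zero ⟧) (rotation s) ⟨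
    sum (λ i → ⟦ lookup d i Fin.≟ zero ⟧)            ≡⟨ count≡sum (Fin._≟ zero) d ⟨
    #zeros d                                        ∎
    where
    open ≡-Reasoning
    π = map position (rotated d s)
    xs = tabulate (front d s)
    fixed? = λ i → lookup π i ≟ position i
    lookup-π : ∀ i → lookup π (inject₁ i) ≡ position (lookup d (i ⊕ s) ⊕ i)
    lookup-π i = trans (lookup-map (inject₁ i) position (rotated d s))
      (cong position (trans (lookup-∷ʳ-inject₁ xs (neg s) i) (lookup∘tabulate (front d s) i)))
    to : ∀ i → lookup π (inject₁ i) ≡ position (inject₁ i) → lookup d (i ⊕ s) ≡ zero
    to i fixed = identityˡ-unique (lookup d (i ⊕ s)) i (position-injective
      (trans (sym (lookup-π i)) (trans fixed (cong suc (Fin.toℕ-inject₁ i)))))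
    from : ∀ i → lookup d (i ⊕ s) ≡ zero → lookup π (inject₁ i) ≡ position (inject₁ i)
    from i d≡0 = trans (lookup-π i) (cong suc
      (trans (cong toℕ (trans (cong (_⊕ i) d≡0) (⊕-identityˡ i))) (sym (Fin.toℕ-inject₁ i))))
    last-unfixed : lookup π (fromℕ m) ≢ position (fromℕ m)
    last-unfixed fixed = <⇒≢ (Fin.toℕ<n (neg s)) (suc-injective (begin
      position (neg s)                      ≡⟨ cong position (lookup-∷ʳ-fromℕ xs (neg s)) ⟨
      position (lookup (rotated d s) (fromℕ m)) ≡⟨ lookup-map (fromℕ m) position (rotated d s) ⟨
      lookup π (fromℕ m)                    ≡⟨ fixed ⟩
      position (fromℕ m)                    ≡⟨ cong suc (Fin.toℕ-fromℕ m) ⟩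
      suc m                                 ∎))

  -- The words d label the orbits; this selects the prime member of each.
  primeRotation : Vec (Fin m) m → Vec ℕ (suc m)
  primeRotation d = map position (rotated d (proj₁ (primeShift p (displaced d))))

  primeRotation-surjective : ∀ π → IsPositivePrime π → ∃[ d ] primeRotation d ≡ π
  primeRotation-surjective π isPP
    -- Primality at j = m says that all m + 1 entries are at most m.
    with toPositions π positive (count-all (_≤? m) π (prime m (s≤s z≤n) ≤-refl))
    where open IsPositivePrime isPP
  ... | ys , refl with rotated-surjective ys
  -- The shift s read off from π is also prime, so uniqueness identifies it with the chosen one.
  ... | d , s , refl = d , cong (map position ∘ rotated d) (primeShift-unique p (displaced d)
          (proj₂ (primeShift p (displaced d))) (positivePrime⇒prime d s isPP))

theorem3p1 : (n k : ℕ) → 2 ≤ n → k ≤ n ∸ 1 →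
    HasCardinality (λ (π : Vec ℕ n) → IsPrimeParkingFunction π × #fixedPoints π ≡ k)
    (((n ∸ 1) C k) * (n ∸ 2) ^ (n ∸ k ∸ 1))
theorem3p1 1 _ (s≤s ()) _
-- With p = n - 2, the words have length n - 1 over n - 1 letters, p of them nonzero; at n = 2 the
-- convention 0⁰ = 1 is how `_^_` computes.
theorem3p1 (2+ p) k _ _ = HasCardinality-image (primeRotation p) injective zeros⇒fixed fixed⇒zeros
  (subst (λ e → HasCardinality (λ (d : Vec (Fin (suc p)) (suc p)) → #zeros d ≡ k) ((suc p C k) * p ^ e))
    exponent (zeros-cardinality p (suc p) k))
  where
  exponent : suc p ∸ k ≡ 2+ p ∸ k ∸ 1
  exponent = trans (cong (2+ p ∸_) (+-comm 1 k)) (sym (∸-+-assoc (2+ p) k 1))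
  injective : ∀ {d d′} → primeRotation p d ≡ primeRotation p d′ → d ≡ d′
  injective = rotated-injective p ∘ map-injective position-injective
  zeros⇒fixed : ∀ d → #zeros d ≡ k → IsPrimeParkingFunction (primeRotation p d) × #fixedPoints (primeRotation p d) ≡ k
  zeros⇒fixed d zeros with primeShift p (displaced p d)
  ... | s , prime = toPrimeParkingFunction (prime⇒positivePrime p d s prime)
                  , trans (#fixedPoints-rotated p d s) zeros
  fixed⇒zeros : ∀ π → IsPrimeParkingFunction π × #fixedPoints π ≡ k → ∃[ d ] #zeros d ≡ k × primeRotation p d ≡ π
  fixed⇒zeros π (isPPF , fixed) with primeRotation-surjective p π (fromPrimeParkingFunction isPPF)
  ... | d , refl = d , trans (sym (#fixedPoints-rotated p d _)) fixed , refl
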